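{- Let $v_1,v_2,\dots,v_n$ be a basis of a vectorial matroid $M$ of rank $n$ whose ground set $S$ contains all the vectors $v_i-v_j$ for $1\le i\neq j\le n$. Then the matrix $A=(a_{ij})_{i,j=1}^n$, whose elements are $a_{ii}=v_1$ for $i=1,\dots,n$, and $a_{ij}=v_i-v_j$ for $1\le i\neq j\le n$, is a matroidal Latin square of order $n$ (over $M$) with no independent transversal of size $n$.
   Context: A vectorial matroid is a matroid whose ground set is a set of vectors in a vector space over a field, a subset being independent exactly when it is linearly independent. A matroidal Latin square (MLS) of degree (also called order) $n$ over a matroid $M$ with ground set $S$ is an $n\times n$ matrix $A$ whose entries are elements of $S$, where each row and each column of $A$ is a base of $M$ (so the $n$ entries of any single row or column are distinct; the same element of $S$ may occur in several cells of $A$ that lie in different rows and columns). An independent transversal of size $n$ of $A$ is an independent set of $n$ entries of $A$, no two of which lie in the same row or column of $A$; that is, it is given by $n$ cells, no two in the same row or column, whose entries are $n$ distinct elements of $S$ forming an independent set of $M$.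
   Formalization: The formal statement assumes n ≥ 2; for n = 1 the claim as printed fails, since the matrix A = (v_1) has the independent transversal {v_1} of size 1. -}

module Defs where

open import Algebra.Apartness.Bundles using (HeytingField; module HeytingField; module HeytingCommutativeRing)
open import Algebra.Bundles using (CommutativeRing)
open import Algebra.Module.Bundles using (Module; module Module)
import Algebra.Properties.CommutativeMonoid.Sum as Sum
open import Data.Bool.Base using (if_then_else_)
open import Data.Fin.Base using (Fin; zero)
open import Data.Fin.Properties using (_≟_)
open import Data.Nat.Base using (ℕ; suc; _<_)
open import Data.Product.Base using (Σ-syntax; ∃-syntax; _×_; proj₁; proj₂)
open import Function.Base using (_∘_)
open import Function.Bundles using (_⇔_)
open import Function.Definitions using (Injective)
open import Level using (Level; _⊔_) renaming (suc to lsuc)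
open import Relation.Binary.Bundles using (Setoid; module Setoid)
open import Relation.Binary.Definitions using (_Respects_)
open import Relation.Binary.PropositionalEquality.Core using (_≡_)
open import Relation.Nullary.Decidable.Core using (does)
open import Relation.Nullary.Negation.Core using (¬_)
open import Relation.Unary using (Pred; _∈_; _∉_; _⊆_; _≐_; _∪_; Empty)

private
  variable
    c ℓ s i a ℓ₁ ℓ₂ m : Level
    k n : ℕ

module _ (E : Setoid c ℓ) where
  open Setoid E using (Carrier; _≈_)

  Distinct : (Fin k → Carrier) → Set ℓ
  Distinct f = Injective _≡_ _≈_ f

  Image : (Fin k → Carrier) → Pred Carrier ℓ
  Image f x = ∃[ t ] x ≈ f t

  HasSize : Pred Carrier ℓ → ℕ → Set (c ⊔ ℓ)
  HasSize X k = Σ[ f ∈ (Fin k → Carrier) ] Distinct f × X ≐ Image f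

  -- The ground set is an arbitrary subset of E.  The axiom `finitary` holds
  -- (classically) for every matroid with a finite ground set and is the usual
  -- extra axiom when the ground set is infinite.  It is phrased with finite families since
  -- a predicate X need not respect _≈_, so Image f need not be contained in X
  -- when all f t belong to X.
  record Matroid (s i : Level) : Set (lsuc (c ⊔ ℓ ⊔ s ⊔ i)) where
    field
      Ground        : Pred Carrier s
      Ground-resp-≈ : Ground Respects _≈_
      Independent   : Pred (Pred Carrier ℓ) i
      independent⇒⊆ : ∀ {X} → Independent X → X ⊆ Ground
      ∅-independent : ∀ {X} → Empty X → Independent X
      hereditary    : ∀ {X Y} → Y ⊆ X → Independent X → Independent Y
      augmentation  : ∀ {X Y p q} → HasSize X p → HasSize Y q → p < q →
                      Independent X → Independent Y →
                      ∃[ y ] y ∈ Y × y ∉ X × Independent (X ∪ (y ≈_))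
      finitary      : ∀ {X} →
                      (∀ {k} (f : Fin k → Carrier) → (∀ t → f t ∈ X) →
                       Independent (Image f)) →
                      Independent X

module _ {E : Setoid c ℓ} (M : Matroid E s i) where
  open Setoid E using (Carrier; _≈_)
  open Matroid M

  -- A base is a maximal independent set.  Maximality is tested on one-element
  -- extensions, because a proper superset given only by ¬ (X ⊆ B) need not
  -- provide a new element constructively.
  IsBase : Pred Carrier ℓ → Set (c ⊔ ℓ ⊔ s ⊔ i)
  IsBase B = Independent B ×
             (∀ {x} → x ∈ Ground → x ∉ B → ¬ Independent (B ∪ (x ≈_)))

  HasRank : ℕ → Set (lsuc ℓ ⊔ c ⊔ s ⊔ i)
  HasRank r = ∃[ B ] IsBase B × HasSize E B r

  IsBaseFamily : (Fin k → Carrier) → Set (c ⊔ ℓ ⊔ s ⊔ i)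
  IsBaseFamily f = Distinct E f × IsBase (Image E f)

  IsMatroidalLatinSquare : (Fin n → Fin n → Carrier) → Set (c ⊔ ℓ ⊔ s ⊔ i)
  IsMatroidalLatinSquare A =
    (∀ r t → A r t ∈ Ground) ×
    (∀ r → IsBaseFamily (A r)) ×
    (∀ t → IsBaseFamily (λ r → A r t))

  IndependentTransversal : (Fin n → Fin n → Carrier) → ℕ → Set (ℓ ⊔ i)
  IndependentTransversal {n} A k =
    Σ[ cell ∈ (Fin k → Fin n × Fin n) ]
      Injective _≡_ _≡_ (proj₁ ∘ cell) ×
      Injective _≡_ _≡_ (proj₂ ∘ cell) ×
      Distinct E (entry cell) ×
      Independent (Image E (entry cell))
    where
    entry : (Fin k → Fin n × Fin n) → Fin k → Carrier
    entry cell t = A (proj₁ (cell t)) (proj₂ (cell t))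

-- In a Heyting field x # y holds exactly when x - y is invertible, and # is
-- tight and irreflexive, so 1# is apart from 0#.  Classically # is ¬ _≈_ and
-- these are the usual fields.
scalars : HeytingField a ℓ₁ ℓ₂ → CommutativeRing a ℓ₁
scalars F = HeytingCommutativeRing.commutativeRing (HeytingField.heytingCommutativeRing F)

VectorSpace : HeytingField a ℓ₁ ℓ₂ → (m ℓ : Level) → Set (a ⊔ ℓ₁ ⊔ lsuc (m ⊔ ℓ))
VectorSpace F m ℓ = Module (scalars F) m ℓ

module _ (F : HeytingField a ℓ₁ ℓ₂) (V : VectorSpace F m ℓ) where
  open HeytingField F using (Carrier; _≈_; 0#)
  open Module V using (Carrierᴹ; _≈ᴹ_; _+ᴹ_; -ᴹ_; _*ₗ_; 0ᴹ; ≈ᴹ-setoid; +ᴹ-commutativeMonoid)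
  open Sum +ᴹ-commutativeMonoid using (sum)

  LinearlyIndependent : Pred Carrierᴹ ℓ → Set (a ⊔ ℓ₁ ⊔ m ⊔ ℓ)
  LinearlyIndependent X =
    ∀ {k} (f : Fin k → Carrierᴹ) → Distinct ≈ᴹ-setoid f → (∀ t → f t ∈ X) →
    (α : Fin k → Carrier) → sum (λ t → α t *ₗ f t) ≈ᴹ 0ᴹ → ∀ t → α t ≈ 0#

  IsVectorial : Matroid ≈ᴹ-setoid s i → Set (a ⊔ ℓ₁ ⊔ m ⊔ lsuc ℓ ⊔ s ⊔ i)
  IsVectorial M = ∀ X → Independent X ⇔ (X ⊆ Ground × LinearlyIndependent X)
    where open Matroid M

  infixl 6 _-ᴹ_
  _-ᴹ_ : Carrierᴹ → Carrierᴹ → Carrierᴹ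
  x -ᴹ y = x +ᴹ (-ᴹ y)

  differenceSquare : (Fin (suc n) → Carrierᴹ) → Fin (suc n) → Fin (suc n) → Carrierᴹ
  differenceSquare v r t = if does (r ≟ t) then v zero else v r -ᴹ v t

{-# OPTIONS --safe #-}

-- Let v be free and suppose Σₜ αₜ aᵣₜ ≈ 0, with total S = Σₜ αₜ.  Since
-- aᵣₜ + vₜ ≈ vᵣ + δᵣₜ v₀, this says Σₜ αₜ vₜ ≈ S vᵣ + αᵣ v₀, so comparing
-- coefficients αⱼ ≈ δᵣⱼ S + δ₀ⱼ αᵣ.  Adding these over j gives S ≈ S + αᵣ, so
-- αᵣ ≈ 0; then j = r gives S ≈ 0, and all αⱼ vanish.  Columns are rows up to
-- signs, and an independent set of the size of a base is a base.
-- For a transversal, give coefficient 1 to the cells off the diagonal and 0 to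
-- the cells on it.  Because every index occurs once as a row and once as a
-- column, the combination telescopes to Σ v - Σ v ≈ 0.  Independence therefore
-- puts all cells on the diagonal, where all entries equal v₀; but a transversal
-- has at least two cells, with distinct entries.
module Submission where

open import Defs
open import Algebra.Apartness.Bundles using (HeytingField)
open import Algebra.Bundles using (CommutativeMonoid; CommutativeRing)
open import Algebra.Module.Bundles using (module Module)
import Algebra.Apartness.Properties.HeytingCommutativeRing as HeytingProperties
import Algebra.Properties.CommutativeMonoid.Sum as Sum
import Algebra.Properties.Group as GroupProperties
import Algebra.Properties.Ring as RingProperties
open import Data.Bool.Base using (if_then_else_)
open import Data.Fin.Base using (Fin; zero; suc; punchIn; punchOut)
open import Data.Fin.Permutation using (Permutation′; permutation; _⟨$⟩ʳ_)
open import Data.Fin.Properties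
  using (_≟_; any?; 0≢1+n; punchInᵢ≢i; punchOut-injective; injective⇒≤)
open import Data.Nat.Base using (ℕ; suc; _≤_; s≤s)
open import Data.Nat.Properties using (1+n≰n; n<1+n)
open import Data.Product.Base using (Σ-syntax; ∃-syntax; _×_; _,_; proj₁; proj₂)
open import Data.Sum.Base using (inj₁; inj₂)
open import Data.Vec.Functional using (_∷_)
open import Function.Base using (_∘_)
open import Function.Bundles using (module Equivalence)
open import Function.Definitions using (Injective)
open import Level using (Level; _⊔_)
open import Relation.Binary.Bundles using (Setoid; module Setoid)
import Relation.Binary.Reasoning.Setoid as SetoidReasoning
open import Relation.Binary.PropositionalEquality.Core as ≡ using (_≡_; _≢_)
open import Relation.Nullary.Decidable.Core using (does; yes; no)
open import Relation.Nullary.Negation.Core using (¬_; contradiction)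
open import Relation.Unary using (_∈_; _∉_; _∪_)

private
  variable
    c ℓ s i a ℓ₁ ℓ₂ m : Level
    k n : ℕ

-- Injective self-maps of a finite index set.

injective⇒preimage : {f : Fin n → Fin n} → Injective _≡_ _≡_ f → ∀ y → ∃[ x ] f x ≡ y
injective⇒preimage {n = suc n} {f} f-injective y with any? (λ x → f x ≟ y)
... | yes preimage = preimage
-- Pigeonhole: if `y` were missed, punching it out of the codomain would inject `Fin (suc n)` into
-- `Fin n`.
... | no y∉f = contradiction
  (injective⇒≤ {f = λ x → punchOut (y≢f x)}
    (λ {x} {x′} eq → f-injective (punchOut-injective (y≢f x) (y≢f x′) eq)))
  1+n≰n
  where
  y≢f : ∀ x → y ≢ f x
  y≢f x y≡fx = y∉f (x , ≡.sym y≡fx)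

injective⇒permutation : {f : Fin n → Fin n} → Injective _≡_ _≡_ f →
                        Σ[ π ∈ Permutation′ n ] (∀ x → π ⟨$⟩ʳ x ≡ f x)
injective⇒permutation {f = f} f-injective =
  permutation f (proj₁ ∘ preimage) (proj₂ ∘ preimage)
    (λ x → f-injective (proj₂ (preimage (f x)))) ,
  λ _ → ≡.refl
  where
  preimage = injective⇒preimage f-injective

-- Finite sums in a commutative monoid.

module _ (C : CommutativeMonoid c ℓ) where
  open CommutativeMonoid C
  open Sum C
  open SetoidReasoning setoid

  sum-single : (f : Fin n → Carrier) (t : Fin n) → (∀ j → j ≢ t → f j ≈ ε) → sum f ≈ f t
  sum-single {n = suc n} f t f≈ε = begin
    sum f                               ≈⟨ sum-remove f ⟩
    f t ∙ sum (λ j → f (punchIn t j))   ≈⟨ ∙-congˡ (sum-cong-≋ (λ j → f≈ε _ (punchInᵢ≢i t j))) ⟩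
    f t ∙ sum {n} (λ _ → ε)             ≈⟨ ∙-congˡ (sum-replicate-zero n) ⟩
    f t ∙ ε                             ≈⟨ identityʳ _ ⟩
    f t                                 ∎

  sum-injective : (f : Fin n → Carrier) {σ : Fin n → Fin n} → Injective _≡_ _≡_ σ →
                  sum (f ∘ σ) ≈ sum f
  sum-injective f {σ} σ-injective with π , π≗σ ← injective⇒permutation σ-injective =
    sym (trans (sum-permute f π) (reflexive (sum-cong-≗ (≡.cong f ∘ π≗σ))))

-- Recognising bases by their size.

module _ {E : Setoid c ℓ} (M : Matroid E s i) where
  open Setoid E
  open Matroid M

  distinct-∷ : {f : Fin k → Carrier} {x : Carrier} → Distinct E f → x ∉ Image E f →
               Distinct E (x ∷ f)
  distinct-∷ f-distinct x∉f {zero}  {zero}  _  = ≡.refl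
  distinct-∷ f-distinct x∉f {zero}  {suc j} eq = contradiction (j , eq) x∉f
  distinct-∷ f-distinct x∉f {suc j} {zero}  eq = contradiction (j , sym eq) x∉f
  distinct-∷ f-distinct x∉f {suc _} {suc _} eq = ≡.cong suc (f-distinct eq)

  hasSize-Image : {f : Fin k → Carrier} → Distinct E f → HasSize E (Image E f) k
  hasSize-Image {f = f} f-distinct = f , f-distinct , (λ z → z) , (λ z → z)

  hasSize-∪ : {f : Fin k → Carrier} {x : Carrier} → Distinct E f → x ∉ Image E f →
              HasSize E (Image E f ∪ (x ≈_)) (suc k)
  hasSize-∪ {f = f} {x} f-distinct x∉f = x ∷ f , distinct-∷ f-distinct x∉f ,
    (λ { (inj₁ (t , eq)) → suc t , eq ; (inj₂ eq) → zero , sym eq }) ,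
    (λ { (zero , eq) → inj₂ (sym eq) ; (suc t , eq) → inj₁ (t , eq) })

  -- If `f` could be enlarged by `x`, the result would have one element more than `b`, so
  -- augmentation would extend `b` and contradict its maximality.
  independent∧size⇒base : {b f : Fin k → Carrier} → IsBaseFamily M b → Distinct E f →
                          Independent (Image E f) → IsBaseFamily M f
  independent∧size⇒base {k = k} {b} {f} (b-distinct , b-independent , b-maximal)
    f-distinct f-independent = f-distinct , f-independent , f-maximal
    where
    f-maximal : ∀ {x} → x ∈ Ground → x ∉ Image E f → ¬ Independent (Image E f ∪ (x ≈_))
    f-maximal x∈S x∉f f∪x-independent
      with y , _ , y∉b , b∪y-independent ←
        augmentation (hasSize-Image b-distinct) (hasSize-∪ f-distinct x∉f) (n<1+n k)
          b-independent f∪x-independent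
      = b-maximal (independent⇒⊆ b∪y-independent (inj₂ refl)) y∉b b∪y-independent

-- Free families and their coefficients.

module _ (F : HeytingField a ℓ₁ ℓ₂) (V : VectorSpace F m ℓ) where
  open CommutativeRing (scalars F) hiding (zero)
  open Module V
  open Sum +-commutativeMonoid using (sum; sum-cong-≋; ∑-distrib-+)
  open Sum +ᴹ-commutativeMonoid using () renaming
    ( sum to sumᴹ; sum-cong-≋ to sumᴹ-cong
    ; ∑-distrib-+ to sumᴹ-distrib-+; ∑-comm to sumᴹ-comm)
  open RingProperties ring using (-‿distribˡ-*; -‿involutive)
  module S = SetoidReasoning setoid
  module R = SetoidReasoning ≈ᴹ-setoid
  module Additive = GroupProperties +-group
  module Additiveᴹ = GroupProperties +ᴹ-group

  -- This makes the members of a free family distinct, and lets a vanishing 0-1 coefficient identify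
  -- a diagonal cell.
  1≉0 : ¬ 1# ≈ 0#
  1≉0 1≈0 = HeytingField.#-irrefl F 1≈0
    (HeytingProperties.1#0 (HeytingField.heytingCommutativeRing F))

  -- Independence of an indexed family rather than of a subset, so that coefficients can be compared
  -- index by index; distinctness of the members is then a consequence.
  Free : (Fin k → Carrierᴹ) → Set (a ⊔ ℓ₁ ⊔ ℓ)
  Free {k} f = ∀ (α : Fin k → Carrier) → sumᴹ (λ t → α t *ₗ f t) ≈ᴹ 0ᴹ → ∀ t → α t ≈ 0#

  -- Kronecker delta. Scaled by `x`, it is the coefficient family of the single vector `x *ₗ f t`.
  δ : Fin n → Fin n → Carrier
  δ t j = if does (t ≟ j) then 1# else 0#

  δ-diagonal : (t : Fin n) → δ t t ≈ 1#
  δ-diagonal t with t ≟ t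
  ... | yes _  = refl
  ... | no t≢t = contradiction ≡.refl t≢t

  δ-off-diagonal : {t j : Fin n} → t ≢ j → δ t j ≈ 0#
  δ-off-diagonal {t = t} {j} t≢j with t ≟ j
  ... | yes t≡j = contradiction t≡j t≢j
  ... | no _    = refl

  sum-δ : (x : Carrier) (t : Fin n) → sum (λ j → δ t j * x) ≈ x
  sum-δ x t = S.begin
    sum (λ j → δ t j * x)  S.≈⟨ sum-single +-commutativeMonoid _ t
                                 (λ j j≢t → trans (*-congʳ (δ-off-diagonal (j≢t ∘ ≡.sym))) (zeroˡ x)) ⟩
    δ t t * x  S.≈⟨ *-congʳ (δ-diagonal t) ⟩
    1# * x     S.≈⟨ *-identityˡ x ⟩
    x          S.∎

  sumᴹ-δ : (x : Carrier) (f : Fin n → Carrierᴹ) (t : Fin n) →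
           sumᴹ (λ j → (δ t j * x) *ₗ f j) ≈ᴹ x *ₗ f t
  sumᴹ-δ x f t = R.begin
    sumᴹ (λ j → (δ t j * x) *ₗ f j)  R.≈⟨ sum-single +ᴹ-commutativeMonoid _ t
      (λ j j≢t → ≈ᴹ-trans
        (*ₗ-congʳ (trans (*-congʳ (δ-off-diagonal (j≢t ∘ ≡.sym))) (zeroˡ x)))
        (*ₗ-zeroˡ _)) ⟩
    (δ t t * x) *ₗ f t  R.≈⟨ *ₗ-congʳ (trans (*-congʳ (δ-diagonal t)) (*-identityˡ x)) ⟩
    x *ₗ f t            R.∎

  sum-*ₗ : (α : Fin n → Carrier) (x : Carrierᴹ) → sumᴹ (λ t → α t *ₗ x) ≈ᴹ sum α *ₗ x
  sum-*ₗ {n = ℕ.zero}  α x = ≈ᴹ-sym (*ₗ-zeroˡ x)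
  sum-*ₗ {n = suc n} α x =
    ≈ᴹ-trans (+ᴹ-congˡ (sum-*ₗ (α ∘ suc) x)) (≈ᴹ-sym (*ₗ-distribʳ x _ _))

  -1*ₗ : (x : Carrierᴹ) → (- 1#) *ₗ x ≈ᴹ -ᴹ x
  -1*ₗ x = Additiveᴹ.inverseˡ-unique _ _ (R.begin
    (- 1#) *ₗ x +ᴹ x        R.≈⟨ +ᴹ-congˡ (*ₗ-identityˡ x) ⟨
    (- 1#) *ₗ x +ᴹ 1# *ₗ x  R.≈⟨ *ₗ-distribʳ x _ _ ⟨
    (- 1# + 1#) *ₗ x        R.≈⟨ *ₗ-congʳ (-‿inverseˡ 1#) ⟩
    0# *ₗ x                 R.≈⟨ *ₗ-zeroˡ x ⟩
    0ᴹ                      R.∎)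

  [x-y]+y≈x : (x y : Carrierᴹ) → x +ᴹ -ᴹ y +ᴹ y ≈ᴹ x
  [x-y]+y≈x x y = ≈ᴹ-trans (+ᴹ-assoc _ _ _) (≈ᴹ-trans (+ᴹ-congˡ (-ᴹ‿inverseˡ y)) (+ᴹ-identityʳ x))

  free-coefficients-unique : {f : Fin n → Carrierᴹ} → Free f → {α β : Fin n → Carrier} →
    sumᴹ (λ t → α t *ₗ f t) ≈ᴹ sumᴹ (λ t → β t *ₗ f t) → ∀ t → α t ≈ β t
  free-coefficients-unique {f = f} f-free {α} {β} eq t =
    Additive.x∙y⁻¹≈ε⇒x≈y _ _ (f-free (λ t → α t - β t) combination t)
    where
    combination : sumᴹ (λ t → (α t - β t) *ₗ f t) ≈ᴹ 0ᴹ
    -- Adding the `β` combination gives the `α` combination, which equals the `β` one; cancelling it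
    -- spares distributing negation over the sum.
    combination = Additiveᴹ.identityˡ-unique _ _ (R.begin
      sumᴹ (λ t → (α t - β t) *ₗ f t) +ᴹ sumᴹ (λ t → β t *ₗ f t)  R.≈⟨ sumᴹ-distrib-+ (λ t → (α t - β t) *ₗ f t) (λ t → β t *ₗ f t) ⟨
      sumᴹ (λ t → (α t - β t) *ₗ f t +ᴹ β t *ₗ f t)               R.≈⟨ sumᴹ-cong (λ t → ≈ᴹ-trans (≈ᴹ-sym (*ₗ-distribʳ (f t) _ _)) (*ₗ-congʳ (Additive.//-rightDividesˡ (β t) (α t)))) ⟩
      sumᴹ (λ t → α t *ₗ f t)                                     R.≈⟨ eq ⟩
      sumᴹ (λ t → β t *ₗ f t)                                     R.∎)

  -- Two equal members at different indices would give one vector two coefficient families, `δ t`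
  -- and `δ j`; comparing them at `t` yields 1 ≈ 0.
  free⇒distinct : {f : Fin n → Carrierᴹ} → Free f → Distinct ≈ᴹ-setoid f
  free⇒distinct {f = f} f-free {t} {j} ft≈fj with t ≟ j
  ... | yes t≡j = t≡j
  ... | no t≢j  = contradiction (S.begin
      1#     S.≈⟨ δ-diagonal t ⟨
      δ t t  S.≈⟨ *-identityʳ _ ⟨
      δ t t * 1#    S.≈⟨ free-coefficients-unique f-free (R.begin
        sumᴹ (λ l → (δ t l * 1#) *ₗ f l)  R.≈⟨ sumᴹ-δ 1# f t ⟩
        1# *ₗ f t                         R.≈⟨ *ₗ-congˡ ft≈fj ⟩
        1# *ₗ f j                         R.≈⟨ sumᴹ-δ 1# f j ⟨
        sumᴹ (λ l → (δ j l * 1#) *ₗ f l)  R.∎) t ⟩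
      δ j t * 1#                          S.≈⟨ *-identityʳ _ ⟩
      δ j t                               S.≈⟨ δ-off-diagonal (t≢j ∘ ≡.sym) ⟩
      0#                                  S.∎) 1≉0

  -- A relation among the `g t` is pushed forward along `σ` to a relation among the members of `f`.
  free-reindex : {f : Fin n → Carrierᴹ} {g : Fin k → Carrierᴹ} {σ : Fin k → Fin n} →
                 Free f → Injective _≡_ _≡_ σ → (∀ t → g t ≈ᴹ f (σ t)) → Free g
  free-reindex {f = f} {g} {σ} f-free σ-injective g≈f∘σ α αg≈0 t = S.begin
    α t       S.≈⟨ *-identityˡ _ ⟨
    1# * α t  S.≈⟨ *-congʳ (δ-diagonal (σ t)) ⟨
    δ (σ t) (σ t) * α t  S.≈⟨ sum-single +-commutativeMonoid _ t
      (λ l l≢t → trans (*-congʳ (δ-off-diagonal (l≢t ∘ σ-injective))) (zeroˡ _)) ⟨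
    β (σ t)  S.≈⟨ f-free β βf≈0 (σ t) ⟩
    0#       S.∎
    where
    β : Fin _ → Carrier
    -- The total of `α` over the fibre of `σ` above `j`. As `σ` is injective, the fibre above `σ t`
    -- contributes `α t` alone.
    β j = sum (λ l → δ (σ l) j * α l)
    βf≈0 : sumᴹ (λ j → β j *ₗ f j) ≈ᴹ 0ᴹ
    βf≈0 = R.begin
      sumᴹ (λ j → β j *ₗ f j)                             R.≈⟨ sumᴹ-cong (λ j → ≈ᴹ-sym (sum-*ₗ (λ l → δ (σ l) j * α l) (f j))) ⟩
      sumᴹ (λ j → sumᴹ (λ l → (δ (σ l) j * α l) *ₗ f j))  R.≈⟨ sumᴹ-comm (λ j l → (δ (σ l) j * α l) *ₗ f j) ⟩
      sumᴹ (λ l → sumᴹ (λ j → (δ (σ l) j * α l) *ₗ f j))  R.≈⟨ sumᴹ-cong (λ l → sumᴹ-δ (α l) f (σ l)) ⟩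
      sumᴹ (λ l → α l *ₗ f (σ l))                         R.≈⟨ sumᴹ-cong (λ l → *ₗ-congˡ (≈ᴹ-sym (g≈f∘σ l))) ⟩
      sumᴹ (λ l → α l *ₗ g l)                             R.≈⟨ αg≈0 ⟩
      0ᴹ                                                  R.∎

  -- Each `ε t` is its own inverse, so `α t` is recovered from the coefficient `α t * ε t` of `f t`.
  free-rescale : {f g : Fin n → Carrierᴹ} (ε : Fin n → Carrier) → (∀ t → ε t * ε t ≈ 1#) →
                 (∀ t → g t ≈ᴹ ε t *ₗ f t) → Free f → Free g
  free-rescale {f = f} {g} ε ε²≈1 g≈εf f-free α αg≈0 t = S.begin
    α t                S.≈⟨ *-identityʳ _ ⟨
    α t * 1#           S.≈⟨ *-congˡ (ε²≈1 t) ⟨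
    α t * (ε t * ε t)  S.≈⟨ *-assoc _ _ _ ⟨
    α t * ε t * ε t    S.≈⟨ *-congʳ (f-free (λ t → α t * ε t) αεf≈0 t) ⟩
    0# * ε t           S.≈⟨ zeroˡ _ ⟩
    0#                 S.∎
    where
    αεf≈0 : sumᴹ (λ t → (α t * ε t) *ₗ f t) ≈ᴹ 0ᴹ
    αεf≈0 = ≈ᴹ-trans
      (sumᴹ-cong (λ t → ≈ᴹ-trans (*ₗ-assoc (α t) (ε t) (f t)) (*ₗ-congˡ (≈ᴹ-sym (g≈εf t)))))
      αg≈0

  -- Each member of a family in the image comes with an index into `f`. Distinct members have
  -- distinct indices, so the family is an injective reindexing of `f`.
  free⇒linearlyIndependent : {f : Fin n → Carrierᴹ} → Free f →
                             LinearlyIndependent F V (Image ≈ᴹ-setoid f)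
  free⇒linearlyIndependent {f = f} f-free g g-distinct g∈f =
    free-reindex f-free σ-injective (proj₂ ∘ g∈f)
    where
    σ-injective : Injective _≡_ _≡_ (proj₁ ∘ g∈f)
    σ-injective {t} {j} eq = g-distinct (≈ᴹ-trans (proj₂ (g∈f t))
      (≈ᴹ-trans (≈ᴹ-reflexive (≡.cong f eq)) (≈ᴹ-sym (proj₂ (g∈f j)))))

  linearlyIndependent⇒free : {f : Fin n → Carrierᴹ} → Distinct ≈ᴹ-setoid f →
                             LinearlyIndependent F V (Image ≈ᴹ-setoid f) → Free f
  linearlyIndependent⇒free {f = f} f-distinct independent =
    independent f f-distinct (λ t → t , ≈ᴹ-refl)

  -- Freeness of a row, with `f` in the role of row `r`.

  module _ {v f : Fin n → Carrierᴹ} (v-free : Free v) (r o : Fin n)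
           (f+v : ∀ t → f t +ᴹ v t ≈ᴹ v r +ᴹ δ r t *ₗ v o) where

    -- The additive hypothesis `f+v` treats diagonal and off-diagonal cells by one equation. Adding
    -- the `α` combination of `v` to the vanishing one turns a relation in the row into an equality
    -- of two combinations of `v`.
    shifted-coefficients : (α : Fin n → Carrier) → sumᴹ (λ t → α t *ₗ f t) ≈ᴹ 0ᴹ →
                           ∀ j → α j ≈ δ r j * sum α + δ o j * α r
    shifted-coefficients α αf≈0 = free-coefficients-unique v-free (R.begin
      sumᴹ (λ t → α t *ₗ v t)
        R.≈⟨ +ᴹ-identityˡ _ ⟨
      0ᴹ +ᴹ sumᴹ (λ t → α t *ₗ v t)
        R.≈⟨ +ᴹ-congʳ αf≈0 ⟨
      sumᴹ (λ t → α t *ₗ f t) +ᴹ sumᴹ (λ t → α t *ₗ v t)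
        R.≈⟨ sumᴹ-distrib-+ (λ t → α t *ₗ f t) (λ t → α t *ₗ v t) ⟨
      sumᴹ (λ t → α t *ₗ f t +ᴹ α t *ₗ v t)
        R.≈⟨ sumᴹ-cong term ⟩
      sumᴹ (λ t → α t *ₗ v r +ᴹ (δ r t * α t) *ₗ v o)
        R.≈⟨ sumᴹ-distrib-+ (λ t → α t *ₗ v r) (λ t → (δ r t * α t) *ₗ v o) ⟩
      sumᴹ (λ t → α t *ₗ v r) +ᴹ sumᴹ (λ t → (δ r t * α t) *ₗ v o)
        R.≈⟨ +ᴹ-cong (sum-*ₗ α (v r)) last-sum ⟩
      sum α *ₗ v r +ᴹ α r *ₗ v o
        -- The two single multiples are spread out as full combinations concentrated at `r` and at
        -- `o`, ready for comparison of coefficients.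
        R.≈⟨ +ᴹ-cong (sumᴹ-δ (sum α) v r) (sumᴹ-δ (α r) v o) ⟨
      sumᴹ (λ j → (δ r j * sum α) *ₗ v j) +ᴹ sumᴹ (λ j → (δ o j * α r) *ₗ v j)
        R.≈⟨ sumᴹ-distrib-+ (λ j → (δ r j * sum α) *ₗ v j) (λ j → (δ o j * α r) *ₗ v j) ⟨
      sumᴹ (λ j → (δ r j * sum α) *ₗ v j +ᴹ (δ o j * α r) *ₗ v j)
        R.≈⟨ sumᴹ-cong (λ j → ≈ᴹ-sym (*ₗ-distribʳ (v j) _ _)) ⟩
      sumᴹ (λ j → (δ r j * sum α + δ o j * α r) *ₗ v j)
        R.∎)
      where
      term : ∀ t → α t *ₗ f t +ᴹ α t *ₗ v t ≈ᴹ α t *ₗ v r +ᴹ (δ r t * α t) *ₗ v o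
      term t = R.begin
        α t *ₗ f t +ᴹ α t *ₗ v t             R.≈⟨ *ₗ-distribˡ _ _ _ ⟨
        α t *ₗ (f t +ᴹ v t)                  R.≈⟨ *ₗ-congˡ (f+v t) ⟩
        α t *ₗ (v r +ᴹ δ r t *ₗ v o)         R.≈⟨ *ₗ-distribˡ _ _ _ ⟩
        α t *ₗ v r +ᴹ α t *ₗ (δ r t *ₗ v o)  R.≈⟨ +ᴹ-congˡ (*ₗ-assoc _ _ _) ⟨
        α t *ₗ v r +ᴹ (α t * δ r t) *ₗ v o   R.≈⟨ +ᴹ-congˡ (*ₗ-congʳ (*-comm _ _)) ⟩
        α t *ₗ v r +ᴹ (δ r t * α t) *ₗ v o   R.∎
      last-sum : sumᴹ (λ t → (δ r t * α t) *ₗ v o) ≈ᴹ α r *ₗ v o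
      last-sum = R.begin
        sumᴹ (λ t → (δ r t * α t) *ₗ v o)  R.≈⟨ sum-single +ᴹ-commutativeMonoid _ r
          (λ j j≢r → ≈ᴹ-trans
            (*ₗ-congʳ (trans (*-congʳ (δ-off-diagonal (j≢r ∘ ≡.sym))) (zeroˡ _)))
            (*ₗ-zeroˡ _)) ⟩
        (δ r r * α r) *ₗ v o  R.≈⟨ *ₗ-congʳ (trans (*-congʳ (δ-diagonal r)) (*-identityˡ _)) ⟩
        α r *ₗ v o            R.∎

    shifted-free : Free f
    shifted-free α αf≈0 = all-zero
      where
      coefficients = shifted-coefficients α αf≈0
      αr≈0 : α r ≈ 0#
      -- Each delta sums to its factor whether or not `r` and `o` coincide, and nothing is divided,
      -- so the characteristic is arbitrary.
      αr≈0 = Additive.identityʳ-unique (sum α) (α r) (sym (S.begin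
        sum α                                                S.≈⟨ sum-cong-≋ coefficients ⟩
        sum (λ j → δ r j * sum α + δ o j * α r)              S.≈⟨ ∑-distrib-+ (λ j → δ r j * sum α) (λ j → δ o j * α r) ⟩
        sum (λ j → δ r j * sum α) + sum (λ j → δ o j * α r)  S.≈⟨ +-cong (sum-δ (sum α) r) (sum-δ (α r) o) ⟩
        sum α + α r                                          S.∎))
      coefficients′ : ∀ j → α j ≈ δ r j * sum α
      coefficients′ j = S.begin
        α j                          S.≈⟨ coefficients j ⟩
        δ r j * sum α + δ o j * α r  S.≈⟨ +-congˡ (trans (*-congˡ αr≈0) (zeroʳ _)) ⟩
        δ r j * sum α + 0#           S.≈⟨ +-identityʳ _ ⟩
        δ r j * sum α                S.∎
      sum≈0 : sum α ≈ 0#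
      sum≈0 = S.begin
        sum α          S.≈⟨ *-identityˡ _ ⟨
        1# * sum α     S.≈⟨ *-congʳ (δ-diagonal r) ⟨
        δ r r * sum α  S.≈⟨ coefficients′ r ⟨
        α r            S.≈⟨ αr≈0 ⟩
        0#             S.∎
      all-zero : ∀ j → α j ≈ 0#
      all-zero j = trans (coefficients′ j) (trans (*-congˡ sum≈0) (zeroʳ _))

  -- Injectivity makes `row` and `col` permutations, so `v ∘ row` and `v ∘ col` have the same sum.
  -- Hence the `ω` combination vanishes, and freeness annihilates its coefficients.
  telescoping-coefficients : {v f : Fin n → Carrierᴹ} {row col : Fin n → Fin n} →
    Injective _≡_ _≡_ row → Injective _≡_ _≡_ col → Free f →
    (ω : Fin n → Carrier) → (∀ t → ω t *ₗ f t +ᴹ v (col t) ≈ᴹ v (row t)) →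
    ∀ t → ω t ≈ 0#
  telescoping-coefficients {v = v} {f} {row} {col} row-injective col-injective f-free ω term =
    f-free ω (Additiveᴹ.identityˡ-unique _ (sumᴹ v) (R.begin
      sumᴹ (λ t → ω t *ₗ f t) +ᴹ sumᴹ v
        R.≈⟨ +ᴹ-congˡ (sum-injective +ᴹ-commutativeMonoid v col-injective) ⟨
      sumᴹ (λ t → ω t *ₗ f t) +ᴹ sumᴹ (v ∘ col)
        R.≈⟨ sumᴹ-distrib-+ (λ t → ω t *ₗ f t) (v ∘ col) ⟨
      sumᴹ (λ t → ω t *ₗ f t +ᴹ v (col t))
        R.≈⟨ sumᴹ-cong term ⟩
      sumᴹ (v ∘ row)
        R.≈⟨ sum-injective +ᴹ-commutativeMonoid v row-injective ⟩
      sumᴹ v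
        R.∎))

  -- Rows, columns and transversals of the difference square.

  module _ (v : Fin (suc n) → Carrierᴹ) where
    private
      A = differenceSquare F V v

    entry-diagonal : {r t : Fin (suc n)} → r ≡ t → A r t ≈ᴹ v zero
    entry-diagonal {r} {t} r≡t with r ≟ t
    ... | yes _  = ≈ᴹ-refl
    ... | no r≢t = contradiction r≡t r≢t

    entry-+ᴹ : ∀ r t → A r t +ᴹ v t ≈ᴹ v r +ᴹ δ r t *ₗ v zero
    entry-+ᴹ r t with r ≟ t
    ... | yes ≡.refl = ≈ᴹ-trans (+ᴹ-comm _ _) (+ᴹ-congˡ (≈ᴹ-sym (*ₗ-identityˡ _)))
    ... | no _       = ≈ᴹ-trans ([x-y]+y≈x (v r) (v t))
                         (≈ᴹ-sym (≈ᴹ-trans (+ᴹ-congˡ (*ₗ-zeroˡ _)) (+ᴹ-identityʳ _)))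

    free-row : Free v → ∀ r → Free (A r)
    free-row v-free r = shifted-free v-free r zero (entry-+ᴹ r)

    -- Transposing the square negates its off-diagonal entries and fixes the diagonal.
    sign : Fin (suc n) → Fin (suc n) → Carrier
    sign t r = if does (t ≟ r) then 1# else - 1#

    sign² : ∀ t r → sign t r * sign t r ≈ 1#
    sign² t r with t ≟ r
    ... | yes _ = *-identityˡ 1#
    ... | no _  = trans (sym (-‿distribˡ-* 1# (- 1#))) (trans (-‿cong (*-identityˡ _)) (-‿involutive 1#))

    entry-transpose : ∀ t r → A r t ≈ᴹ sign t r *ₗ A t r
    entry-transpose t r with t ≟ r
    ... | yes t≡r = ≈ᴹ-trans (entry-diagonal (≡.sym t≡r)) (≈ᴹ-sym (*ₗ-identityˡ _))
    -- `sign t r` and `A t r` branch on `t ≟ r`, but `A r t` branches on `r ≟ t`, so the opposite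
    -- test must be decided too.
    ... | no t≢r with r ≟ t
    ...   | yes r≡t = contradiction (≡.sym r≡t) t≢r
    ...   | no _    = ≈ᴹ-sym (≈ᴹ-trans (-1*ₗ _) (≈ᴹ-trans
        (Additiveᴹ.⁻¹-anti-homo-∙ (v t) (-ᴹ v r))
        (+ᴹ-congʳ (Additiveᴹ.⁻¹-involutive (v r)))))

    free-column : Free v → ∀ t → Free (λ r → A r t)
    free-column v-free t =
      free-rescale (sign t) (sign² t) (entry-transpose t) (free-row v-free t)

    -- The coefficients of the telescoping combination: omitting the diagonal cells leaves only
    -- differences of vectors of `v`.
    δᶜ : Fin (suc n) → Fin (suc n) → Carrier
    δᶜ r t = if does (r ≟ t) then 0# else 1#

    δᶜ≈0⇒≡ : {r t : Fin (suc n)} → δᶜ r t ≈ 0# → r ≡ t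
    δᶜ≈0⇒≡ {r} {t} δᶜ≈0 with r ≟ t
    ... | yes r≡t = r≡t
    ... | no _    = contradiction δᶜ≈0 1≉0

    δᶜ-entry-+ᴹ : ∀ r t → δᶜ r t *ₗ A r t +ᴹ v t ≈ᴹ v r
    δᶜ-entry-+ᴹ r t with r ≟ t
    ... | yes ≡.refl = ≈ᴹ-trans (+ᴹ-congʳ (*ₗ-zeroˡ _)) (+ᴹ-identityˡ _)
    ... | no _       = ≈ᴹ-trans (+ᴹ-congʳ (*ₗ-identityˡ _)) ([x-y]+y≈x (v r) (v t))

    transversal-on-diagonal : {row col : Fin (suc n) → Fin (suc n)} →
      Injective _≡_ _≡_ row → Injective _≡_ _≡_ col →
      Free (λ t → A (row t) (col t)) → ∀ t → row t ≡ col t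
    transversal-on-diagonal {row} {col} row-injective col-injective free t =
      δᶜ≈0⇒≡ (telescoping-coefficients {v = v} row-injective col-injective free
        (λ t → δᶜ (row t) (col t)) (λ t → δᶜ-entry-+ᴹ (row t) (col t)) t)

theorem3p1 : ∀ {a ℓ₁ ℓ₂ m ℓ s i : Level}
    (F : HeytingField a ℓ₁ ℓ₂) (V : VectorSpace F m ℓ)
    (M : Matroid (Module.≈ᴹ-setoid V) s i) → IsVectorial F V M →
    (p : ℕ) → let n = suc p in 2 ≤ n →
    HasRank M n →
    (v : Fin n → Module.Carrierᴹ V) → IsBaseFamily M v →
    (∀ (r t : Fin n) → r ≢ t → _-ᴹ_ F V (v r) (v t) ∈ Matroid.Ground M) →
    IsMatroidalLatinSquare M (differenceSquare F V v) ×
    ¬ IndependentTransversal M (differenceSquare F V v) n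
theorem3p1 F V M vectorial (suc p) (s≤s (s≤s _)) _ v v-base@(v-distinct , v-independent , _) differences∈S =
  (entry∈S ,
   (λ r → baseFamily (entry∈S r) (free-row F V v v-free r)) ,
   (λ t → baseFamily (λ r → entry∈S r t) (free-column F V v v-free t))) ,
  no-transversal
  where
  open Module V using (Carrierᴹ; ≈ᴹ-setoid; ≈ᴹ-refl; ≈ᴹ-sym; ≈ᴹ-trans)
  open Matroid M

  A = differenceSquare F V v

  v-free : Free F V v
  v-free = linearlyIndependent⇒free F V v-distinct
    (proj₂ (Equivalence.to (vectorial _) v-independent))

  entry∈S : ∀ r t → A r t ∈ Ground
  entry∈S r t with r ≟ t
  -- The diagonal entry lies in the ground set as a member of the base `v`.
  ... | yes _  = independent⇒⊆ v-independent (zero , ≈ᴹ-refl)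
  ... | no r≢t = differences∈S r t r≢t

  baseFamily : {f : Fin (suc (suc p)) → Carrierᴹ} → (∀ t → f t ∈ Ground) → Free F V f →
               IsBaseFamily M f
  baseFamily f∈S f-free = independent∧size⇒base M v-base (free⇒distinct F V f-free)
    (Equivalence.from (vectorial _)
      -- `Image` is closed under the setoid equality, so membership in the ground set must be
      -- transported along it.
      ((λ { (t , x≈ft) → Ground-resp-≈ (≈ᴹ-sym x≈ft) (f∈S t) }) ,
       free⇒linearlyIndependent F V f-free))

  no-transversal : ¬ IndependentTransversal M A (suc (suc p))
  no-transversal (cell , row-injective , col-injective , distinct , independent) =
    -- The bound 2 ≤ n supplies the two indices. For n = 1 the single cell, with entry `v zero`,
    -- would be an independent transversal.
    0≢1+n (distinct (≈ᴹ-trans (v₀ zero) (≈ᴹ-sym (v₀ (suc zero)))))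
    where
    diagonal = transversal-on-diagonal F V v row-injective col-injective
      (linearlyIndependent⇒free F V distinct (proj₂ (Equivalence.to (vectorial _) independent)))
    v₀ = λ t → entry-diagonal F V v (diagonal t)
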